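{- For any integers $i,j$ with $3\le i\le j$, there exists a finite connected simple graph $G$ with $\operatorname{gon}(G)=i$ and $\operatorname{mfgon}(G)=j$.
   Context: Graphs are finite and connected; in general they may have multiple edges but no loops, and "simple" means no multiple edges. A divisor on $G$ is an integer combination $D=\sum_{v\in V(G)}D(v)\,(v)$, with degree $\deg(D)=\sum_v D(v)$; $D$ is effective if $D(v)\ge0$ for all $v$. Two divisors are equivalent if their difference lies in the integer column space of the Laplacian matrix of $G$ (equivalently, they differ by a sequence of chip-firing moves, where firing $v$ sends one chip along each edge incident to $v$). The rank $r(D)$ is $-1$ if $D$ is not equivalent to an effective divisor, and otherwise the largest integer $r\ge0$ such that $D-E$ is equivalent to an effective divisor for every effective $E$ of degree $r$. The (divisorial) gonality $\operatorname{gon}(G)$ is the minimum degree of a divisor of positive rank. An effective divisor $D$ is multiplicity-free if $D(v)\le1$ for all $v$; the multiplicity-free gonality $\operatorname{mfgon}(G)$ is the minimum degree of a multiplicity-free divisor of positive rank. -}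

module Defs where

open import Data.Nat using (ℕ; zero; suc; _≤_)
open import Data.Integer as ℤ using (ℤ; +_; _-_; _*_; _+_)
open import Data.Fin using (Fin)
open import Data.Fin.Properties using ()
open import Data.Vec.Functional using (Vector; foldr)
open import Data.Product using (Σ; _×_; _,_; ∃)
open import Relation.Binary.PropositionalEquality using (_≡_; _≢_)

sumℤ : ∀ {n} → (Fin n → ℤ) → ℤ
sumℤ {n} f = foldr _+_ (+ 0) f

-- A finite multigraph on the vertex set Fin n, given by edge multiplicities.
record Graph : Set where
  field
    n         : ℕ
    mult      : Fin n → Fin n → ℕ
    symmetric : ∀ u v → mult u v ≡ mult v u
    loopless  : ∀ v → mult v v ≡ 0

open Graph public

data Reachable (G : Graph) : Fin (n G) → Fin (n G) → Set where
  here : ∀ {v} → Reachable G v v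
  step : ∀ {u w v} → 1 ≤ mult G u w → Reachable G w v → Reachable G u v

Connected : Graph → Set
Connected G = ∀ u v → Reachable G u v

Simple : Graph → Set
Simple G = ∀ u v → mult G u v ≤ 1

Divisor : Graph → Set
Divisor G = Fin (n G) → ℤ

deg : ∀ {G} → Divisor G → ℤ
deg D = sumℤ D

Effective : ∀ {G} → Divisor G → Set
Effective D = ∀ v → + 0 ℤ.≤ D v

MultiplicityFree : ∀ {G} → Divisor G → Set
MultiplicityFree {G} D = Effective {G} D × (∀ v → D v ℤ.≤ + 1)

valence : (G : Graph) → Fin (n G) → ℤ
valence G v = sumℤ (λ u → + mult G v u)

laplacian : (G : Graph) → (Fin (n G) → ℤ) → Divisor G
laplacian G z v = valence G v * z v - sumℤ (λ u → + mult G v u * z u)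

Equiv : ∀ {G} → Divisor G → Divisor G → Set
Equiv {G} D D' = ∃ λ (z : Fin (n G) → ℤ) → ∀ v → D v - D' v ≡ laplacian G z v

EquivEffective : ∀ {G} → Divisor G → Set
EquivEffective {G} D = ∃ λ (E : Divisor G) → Effective {G} E × Equiv {G} D E

-- r(D) ≥ k  (for k ≥ 0): D - E is equivalent to an effective divisor for
-- every effective E of degree k.  (For k = 0 this says D is equivalent to
-- an effective divisor, i.e. r(D) ≠ -1.)
RankAtLeast : ∀ {G} → ℕ → Divisor G → Set
RankAtLeast {G} k D =
  ∀ (E : Divisor G) → Effective {G} E → deg {G} E ≡ + k →
    EquivEffective {G} (λ v → D v - E v)

PositiveRank : ∀ {G} → Divisor G → Set
PositiveRank {G} D = RankAtLeast {G} 1 D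

GonalityIs : Graph → ℕ → Set
GonalityIs G k =
  (∃ λ (D : Divisor G) → PositiveRank {G} D × deg {G} D ≡ + k)
  × (∀ (D : Divisor G) → PositiveRank {G} D → + k ℤ.≤ deg {G} D)

MFGonalityIs : Graph → ℕ → Set
MFGonalityIs G k =
  (∃ λ (D : Divisor G) → MultiplicityFree {G} D × PositiveRank {G} D × deg {G} D ≡ + k)
  × (∀ (D : Divisor G) → MultiplicityFree {G} D → PositiveRank {G} D → + k ℤ.≤ deg {G} D)

{-# OPTIONS --safe #-}

-- Let p = i - 1, t = j - i + 1 and M = p + t = j. Join each of p core vertices to each of M mids and t hubs,
-- and attach to the k-th hub a tip that is also adjacent to one fixed core vertex a. Two chips on a and one
-- on every other core vertex can fire into any mid and into any pair {hub k, tip k}; one chip on every core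
-- vertex and every hub can fire into any mid and any tip.
-- Conversely, let D be effective of degree < M. A legally fired set contains all the core or misses it, as
-- separating two core vertices cuts at least M edges. If some core vertex is empty (consider an empty mid),
-- or if some pair {hub k, tip k} is empty and D(a) ≤ 1 (consider that tip), then D can only reach that
-- vertex by first firing a set that misses the core. In such a set some vertex has two edges to the
-- complement, so D is not multiplicity-free; and firing it brings chips to a, so that it cannot go on
-- forever. Multiplicity-free divisors of degree < j and divisors of degree < i always are in this situation.
module Submission where

open import Defs
open import Data.Nat using (ℕ; _≤_)
open import Data.Product using (Σ; _×_)
open import Algebra.Properties.Semiring.Sum using
  (∑-distrib-+; ∑-comm; sum-cong-≗; sum-replicate-zero; *-distribʳ-sum)
open import Data.Bool using (Bool; true; false; not; _∨_)
open import Data.Bool.Properties using (not-involutive; ∨-zeroʳ; ¬-not)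
open import Data.Empty using (⊥; ⊥-elim)
open import Data.Fin using (Fin; zero; suc; _↑ˡ_; _↑ʳ_; splitAt)
open import Data.Fin.Properties using (_≟_; any?; splitAt-↑ˡ; splitAt-↑ʳ; splitAt⁻¹-↑ˡ; splitAt⁻¹-↑ʳ)
open import Data.Integer as ℤ using (ℤ; +_; -_; _+_; _-_; _*_)
import Data.Integer.Properties as ℤ
open import Data.Integer.Tactic.RingSolver using (solve-∀)
open import Data.Nat as ℕ using (zero; suc; z≤n; s≤s)
import Data.Nat.Properties as ℕ
open import Data.Product using (∃; _,_; proj₁; proj₂)
open import Data.Sum using (_⊎_; inj₁; inj₂; [_,_]′)
open import Function using (_∘_)
open import Relation.Binary.PropositionalEquality
open import Relation.Nullary using (Dec; yes; no; does; ¬_; contradiction)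
open import Relation.Nullary.Decidable using (dec-true; dec-false; _×-dec_)

-- Indicators, unit chips and integer inequalities

⟦_⟧ : Bool → ℤ
⟦ true ⟧ = + 1
⟦ false ⟧ = + 0

0≤⟦_⟧ : ∀ b → + 0 ℤ.≤ ⟦ b ⟧
0≤⟦ true ⟧ = ℤ.+≤+ z≤n
0≤⟦ false ⟧ = ℤ.≤-refl

⟦b⟧+⟦not-b⟧≡1 : ∀ b → ⟦ b ⟧ + ⟦ not b ⟧ ≡ + 1
⟦b⟧+⟦not-b⟧≡1 true = refl
⟦b⟧+⟦not-b⟧≡1 false = refl

δ : ∀ {n} → Fin n → Fin n → ℤ
δ r v = ⟦ does (r ≟ v) ⟧

δ-refl : ∀ {n} (r : Fin n) → δ r r ≡ + 1
δ-refl r = cong ⟦_⟧ (dec-true (r ≟ r) refl)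

-- The ring solver proves equations only. An inequality is therefore obtained from a known one by
-- showing that both have the same difference of sides.
shift-≤ : ∀ {a b c d} → a ℤ.≤ b → d - c ≡ b - a → c ℤ.≤ d
shift-≤ a≤b eq = ℤ.0≤i-j⇒j≤i (subst (+ 0 ℤ.≤_) (sym eq) (ℤ.i≤j⇒0≤j-i a≤b))

≰0⇒1≤ : ∀ {x} → ¬ (x ℤ.≤ + 0) → + 1 ℤ.≤ x
≰0⇒1≤ x≰0 = ℤ.i<j⇒suc[i]≤j (ℤ.≰⇒> x≰0)

0≤*0≤ : ∀ m {x} → + 0 ℤ.≤ x → + 0 ℤ.≤ + m * x
0≤*0≤ m {x} 0≤x = subst (ℤ._≤ + m * x) (ℤ.*-zeroʳ (+ m)) (ℤ.*-monoˡ-≤-nonNeg (+ m) 0≤x)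

1≤*1 : ∀ {m} → 1 ≤ m → + 1 ℤ.≤ + m * + 1
1≤*1 {m} 1≤m = subst (+ 1 ℤ.≤_) (sym (ℤ.*-identityʳ (+ m))) (ℤ.+≤+ 1≤m)

-- Finite sums

sum-mono : ∀ {n} {f g : Fin n → ℤ} → (∀ v → f v ℤ.≤ g v) → sumℤ f ℤ.≤ sumℤ g
sum-mono {zero} f≤g = ℤ.≤-refl
sum-mono {suc n} f≤g = ℤ.+-mono-≤ (f≤g zero) (sum-mono (f≤g ∘ suc))

sum-zero : ∀ n → sumℤ {n} (λ _ → + 0) ≡ + 0
sum-zero = sum-replicate-zero ℤ.+-*-semiring

sum-ones : ∀ n → sumℤ {n} (λ _ → + 1) ≡ + n
sum-ones zero = refl
sum-ones (suc n) = cong (λ s → + 1 + s) (sum-ones n)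

sum-cong : ∀ {n} {f g : Fin n → ℤ} → f ≗ g → sumℤ f ≡ sumℤ g
sum-cong = sum-cong-≗ ℤ.+-*-semiring

sum-nonneg : ∀ {n} {f : Fin n → ℤ} → (∀ v → + 0 ℤ.≤ f v) → + 0 ℤ.≤ sumℤ f
sum-nonneg {n} {f} 0≤f = subst (ℤ._≤ sumℤ f) (sum-zero n) (sum-mono 0≤f)

sum-atLeast-ones : ∀ {n} {f : Fin n → ℤ} → (∀ v → + 1 ℤ.≤ f v) → + n ℤ.≤ sumℤ f
sum-atLeast-ones {n} {f} 1≤f = subst (ℤ._≤ sumℤ f) (sum-ones n) (sum-mono 1≤f)

sum-+ : ∀ {n} (f g : Fin n → ℤ) → sumℤ (λ v → f v + g v) ≡ sumℤ f + sumℤ g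
sum-+ = ∑-distrib-+ ℤ.+-*-semiring

sum-neg : ∀ {n} (f : Fin n → ℤ) → sumℤ (λ v → - f v) ≡ - sumℤ f
sum-neg {zero} f = refl
sum-neg {suc n} f = trans (cong (λ s → - f zero + s) (sum-neg (f ∘ suc)))
                          (sym (ℤ.neg-distrib-+ (f zero) (sumℤ (f ∘ suc))))

sum-sub : ∀ {n} (f g : Fin n → ℤ) → sumℤ (λ v → f v - g v) ≡ sumℤ f - sumℤ g
sum-sub f g = trans (sum-+ f (-_ ∘ g)) (cong (λ s → sumℤ f + s) (sum-neg g))

term≤sum : ∀ {n} {f : Fin n → ℤ} → (∀ v → + 0 ℤ.≤ f v) → ∀ u → f u ℤ.≤ sumℤ f
term≤sum {f = f} 0≤f zero =
  subst (ℤ._≤ sumℤ f) (ℤ.+-identityʳ (f zero)) (ℤ.+-monoʳ-≤ (f zero) (sum-nonneg (0≤f ∘ suc)))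
term≤sum {f = f} 0≤f (suc u) =
  subst (ℤ._≤ sumℤ f) (ℤ.+-identityˡ (f (suc u))) (ℤ.+-mono-≤ (0≤f zero) (term≤sum (0≤f ∘ suc) u))

two-terms≤sum : ∀ {n} {f : Fin n → ℤ} → (∀ v → + 0 ℤ.≤ f v) →
  ∀ {u w} → u ≢ w → f u + f w ℤ.≤ sumℤ f
two-terms≤sum 0≤f {zero} {zero} u≢w = contradiction refl u≢w
two-terms≤sum {f = f} 0≤f {zero} {suc w} u≢w = ℤ.+-monoʳ-≤ (f zero) (term≤sum (0≤f ∘ suc) w)
two-terms≤sum {f = f} 0≤f {suc u} {zero} u≢w =
  subst (ℤ._≤ sumℤ f) (ℤ.+-comm (f zero) (f (suc u)))
    (ℤ.+-monoʳ-≤ (f zero) (term≤sum (0≤f ∘ suc) u))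
two-terms≤sum {f = f} 0≤f {suc u} {suc w} u≢w =
  subst (ℤ._≤ sumℤ f) (ℤ.+-identityˡ (f (suc u) + f (suc w)))
    (ℤ.+-mono-≤ (0≤f zero) (two-terms≤sum (0≤f ∘ suc) (u≢w ∘ cong suc)))

sum-δ : ∀ {n} (f : Fin n → ℤ) r → sumℤ (λ u → f u * δ r u) ≡ f r
sum-δ {suc n} f zero = trans
  (cong₂ _+_ (ℤ.*-identityʳ (f zero)) (trans (sum-cong (ℤ.*-zeroʳ ∘ f ∘ suc)) (sum-zero n)))
  (ℤ.+-identityʳ (f zero))
sum-δ f (suc r) = trans (cong₂ _+_ (ℤ.*-zeroʳ (f zero)) (sum-δ (f ∘ suc) r)) (ℤ.+-identityˡ (f (suc r)))

sum-splitAt : ∀ m {n} (f : Fin (m ℕ.+ n) → ℤ) →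
  sumℤ f ≡ sumℤ (λ u → f (u ↑ˡ n)) + sumℤ (λ u → f (m ↑ʳ u))
sum-splitAt zero f = sym (ℤ.+-identityˡ (sumℤ f))
sum-splitAt (suc m) f =
  trans (cong (λ s → f zero + s) (sum-splitAt m (f ∘ suc))) (sym (ℤ.+-assoc (f zero) _ _))

-- An effective divisor of degree one is a single chip. Either the first entry vanishes and the tail
-- still sums to one, or the first entry uses up the whole sum and nothing is left for the tail.
-- Only the upper bound by `δ q` is recorded, since this is what subtracting the chip requires.
sum≡1⇒≤δ : ∀ {n} {f : Fin n → ℤ} → (∀ v → + 0 ℤ.≤ f v) → sumℤ f ≡ + 1 →
  ∃ λ q → ∀ v → f v ℤ.≤ δ q v
sum≡1⇒≤δ {zero} 0≤f ()
sum≡1⇒≤δ {suc n} {f} 0≤f Σ≡1 with f zero ℤ.≤? + 0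
... | yes f₀≤0 = let q , f≤δ = sum≡1⇒≤δ (0≤f ∘ suc) tail≡1 in
      suc q , λ { zero → f₀≤0 ; (suc v) → f≤δ v }
  where
  tail≡1 : sumℤ (f ∘ suc) ≡ + 1
  tail≡1 = trans (sym (ℤ.+-identityˡ _))
                 (trans (cong (λ s → s + sumℤ (f ∘ suc)) (ℤ.≤-antisym (0≤f zero) f₀≤0)) Σ≡1)
... | no f₀≰0 = zero , λ
      { zero → subst (f zero ℤ.≤_) Σ≡1 (term≤sum 0≤f zero)
      ; (suc v) → ℤ.≤-trans (term≤sum (0≤f ∘ suc) v) tail≤0 }
  where
  tail≤0 : sumℤ (f ∘ suc) ℤ.≤ + 0
  tail≤0 = shift-≤ (≰0⇒1≤ f₀≰0)
    (trans (regroup (f zero) (sumℤ (f ∘ suc))) (cong (λ s → f zero - s) Σ≡1))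
    where
    regroup : ∀ a b → + 0 - b ≡ a - (a + b)
    regroup = solve-∀

sum-δ-one : ∀ {n} (q : Fin n) → sumℤ (δ q) ≡ + 1
sum-δ-one q = trans (sum-cong (λ u → sym (ℤ.*-identityˡ (δ q u)))) (sum-δ (λ _ → + 1) q)

argmax : ∀ {n} → Fin n → (z : Fin n → ℤ) → ∃ λ t → ∀ v → z v ℤ.≤ z t
argmax {suc zero} _ z = zero , λ { zero → ℤ.≤-refl }
argmax {suc (suc n)} _ z with argmax zero (z ∘ suc)
... | t , max with z zero ℤ.≤? z (suc t)
...   | yes z₀≤ = suc t , λ { zero → z₀≤ ; (suc v) → max v }
...   | no z₀≰ = zero , λ { zero → ℤ.≤-refl ; (suc v) → ℤ.≤-trans (max v) (ℤ.<⇒≤ (ℤ.≰⇒> z₀≰)) }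

-- Chip firing

module _ (G : Graph) where

  private
    L = laplacian G
    V = Fin (n G)

    e : V → V → ℤ
    e u v = + mult G u v

  -- In this form the value at `v` depends only on how far `z v` exceeds its neighbours: constant
  -- scripts vanish, and at a maximum of `z` the value is nonnegative.
  laplacian-differences : ∀ z v → L z v ≡ sumℤ (λ u → e v u * (z v - z u))
  laplacian-differences z v = begin
    valence G v * z v - sumℤ (λ u → e v u * z u)
      ≡⟨ cong (λ s → s - sumℤ (λ u → e v u * z u)) (*-distribʳ-sum ℤ.+-*-semiring (z v) (e v)) ⟩
    sumℤ (λ u → e v u * z v) - sumℤ (λ u → e v u * z u)
      ≡⟨ sym (sum-sub (λ u → e v u * z v) (λ u → e v u * z u)) ⟩
    sumℤ (λ u → e v u * z v - e v u * z u)
      ≡⟨ sum-cong (λ u → factor (e v u) (z v) (z u)) ⟩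
    sumℤ (λ u → e v u * (z v - z u)) ∎
    where
    open ≡-Reasoning
    factor : ∀ a b c → a * b - a * c ≡ a * (b - c)
    factor = solve-∀

  laplacian-sub : ∀ z w v → L (λ u → z u - w u) v ≡ L z v - L w v
  laplacian-sub z w v = begin
    L (λ u → z u - w u) v
      ≡⟨ laplacian-differences (λ u → z u - w u) v ⟩
    sumℤ (λ u → e v u * ((z v - w v) - (z u - w u)))
      ≡⟨ sum-cong (λ u → regroup (e v u) (z v) (w v) (z u) (w u)) ⟩
    sumℤ (λ u → e v u * (z v - z u) - e v u * (w v - w u))
      ≡⟨ sum-sub (λ u → e v u * (z v - z u)) (λ u → e v u * (w v - w u)) ⟩
    sumℤ (λ u → e v u * (z v - z u)) - sumℤ (λ u → e v u * (w v - w u))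
      ≡⟨ sym (cong₂ _-_ (laplacian-differences z v) (laplacian-differences w v)) ⟩
    L z v - L w v ∎
    where
    open ≡-Reasoning
    regroup : ∀ a b c d f → a * ((b - c) - (d - f)) ≡ a * (b - d) - a * (c - f)
    regroup = solve-∀

  laplacian-zero : ∀ v → L (λ _ → + 0) v ≡ + 0
  laplacian-zero v = trans (laplacian-differences (λ _ → + 0) v)
    (trans (sum-cong (λ u → ℤ.*-zeroʳ (e v u))) (sum-zero (n G)))

  -- Exchanging the double sum turns row sums into column sums, which are valences because
  -- multiplicities are symmetric.
  deg-laplacian : ∀ z → sumℤ (L z) ≡ + 0
  deg-laplacian z = begin
    sumℤ (λ v → valence G v * z v - sumℤ (λ u → e v u * z u))
      ≡⟨ sum-sub (λ v → valence G v * z v) (λ v → sumℤ (λ u → e v u * z u)) ⟩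
    sumℤ (λ v → valence G v * z v) - sumℤ (λ v → sumℤ (λ u → e v u * z u))
      ≡⟨ cong (λ s → sumℤ (λ v → valence G v * z v) - s)
           (trans (∑-comm ℤ.+-*-semiring (λ v u → e v u * z u)) (sum-cong column)) ⟩
    sumℤ (λ v → valence G v * z v) - sumℤ (λ v → valence G v * z v)
      ≡⟨ ℤ.+-inverseʳ (sumℤ (λ v → valence G v * z v)) ⟩
    + 0 ∎
    where
    open ≡-Reasoning
    column : ∀ u → sumℤ (λ v → e v u * z u) ≡ valence G u * z u
    column u = trans (sum-cong (λ v → cong (λ m → + m * z u) (symmetric G v u)))
                     (sym (*-distribʳ-sum ℤ.+-*-semiring (z u) (e u)))

  -- `L z v` is the number of chips that `v` loses under the script `z`, so `D` becomes effective
  -- with a chip left on `q`. Reaching every vertex is equivalent to positive rank, and no effective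
  -- divisor has to be named.
  Reaches : (V → ℤ) → V → Set
  Reaches D q = ∃ λ z → ∀ v → L z v + δ q v ℤ.≤ D v

  positiveRank⇒reaches : ∀ D → PositiveRank {G} D → ∀ q → Reaches D q
  positiveRank⇒reaches D rank q with rank (δ q) (λ v → 0≤⟦ does (q ≟ v) ⟧) (sum-δ-one q)
  ... | E , 0≤E , z , eq = z , λ v → shift-≤ (0≤E v) (begin
      D v - (L z v + δ q v)           ≡⟨ regroup (D v) (δ q v) (E v) (L z v) ⟩
      (D v - δ q v - E v) - L z v + E v ≡⟨ cong (λ s → s - L z v + E v) (eq v) ⟩
      L z v - L z v + E v             ≡⟨ cancel (L z v) (E v) ⟩
      E v - + 0                       ∎)
    where
    open ≡-Reasoning
    regroup : ∀ d a b l → d - (l + a) ≡ (d - a - b) - l + b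
    regroup = solve-∀
    cancel : ∀ l b → l - l + b ≡ b - + 0
    cancel = solve-∀

  reaches⇒positiveRank : ∀ {D} → (∀ q → Reaches D q) → PositiveRank {G} D
  reaches⇒positiveRank {D} reach E 0≤E degE =
    let q , E≤δ = sum≡1⇒≤δ 0≤E degE
        z , legal = reach q
    in (λ v → D v - E v - L z v)
     , (λ v → shift-≤ (ℤ.≤-trans (ℤ.+-monoʳ-≤ (L z v) (E≤δ v)) (legal v)) (regroup (D v) (E v) (L z v)))
     , z , λ v → cancel (D v) (E v) (L z v)
    where
    regroup : ∀ d b l → d - b - l - + 0 ≡ d - (l + b)
    regroup = solve-∀
    cancel : ∀ d b l → (d - b) - (d - b - l) ≡ l
    cancel = solve-∀

  -- The script `z - w` undoes `w` and then performs `z`.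
  reaches-fire : ∀ D {q} w → Reaches D q → Reaches (λ v → D v - L w v) q
  reaches-fire D {q} w (z , legal) = (λ v → z v - w v) , λ v → shift-≤ (legal v)
    (trans (cong (λ s → D v - L w v - (s + δ q v)) (laplacian-sub z w v))
           (regroup (D v) (L w v) (L z v) (δ q v)))
    where
    regroup : ∀ d a b c → d - a - ((b - a) + c) ≡ d - (b + c)
    regroup = solve-∀

  reaches-support : ∀ {D q} → Effective {G} D → + 1 ℤ.≤ D q → Reaches D q
  reaches-support {D} {q} 0≤D 1≤Dq = (λ _ → + 0) , bound
    where
    bound : ∀ v → L (λ _ → + 0) v + δ q v ℤ.≤ D v
    bound v rewrite laplacian-zero v | ℤ.+-identityˡ (δ q v) with q ≟ v
    ... | yes refl = 1≤Dq
    ... | no _ = 0≤D v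

  deg-fire : ∀ D z → sumℤ (λ v → D v - L z v) ≡ sumℤ D
  deg-fire D z = trans (sum-sub D (L z))
    (trans (cong (λ s → sumℤ D - s) (deg-laplacian z)) (ℤ.+-identityʳ (sumℤ D)))

  -- Firing sets of vertices

  Legal : (V → ℤ) → (V → Bool) → Set
  Legal D A = ∀ v → L (⟦_⟧ ∘ A) v ℤ.≤ D v

  laplacian-inside : ∀ {A v} → A v ≡ true → L (⟦_⟧ ∘ A) v ≡ sumℤ (λ u → e v u * ⟦ not (A u) ⟧)
  laplacian-inside {A} {v} v∈A = trans (laplacian-differences (⟦_⟧ ∘ A) v)
    (sum-cong λ u → cong (e v u *_) (trans (cong (λ b → ⟦ b ⟧ - ⟦ A u ⟧) v∈A) (flip (A u))))
    where
    flip : ∀ b → + 1 - ⟦ b ⟧ ≡ ⟦ not b ⟧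
    flip true = refl
    flip false = refl

  laplacian-outside : ∀ {A v} → A v ≡ false → L (⟦_⟧ ∘ A) v ≡ - sumℤ (λ u → e v u * ⟦ A u ⟧)
  laplacian-outside {A} {v} v∉A = trans (laplacian-differences (⟦_⟧ ∘ A) v)
    (trans (sum-cong λ u → trans (cong (λ b → e v u * (⟦ b ⟧ - ⟦ A u ⟧)) v∉A) (neg (e v u) ⟦ A u ⟧))
           (sum-neg (λ u → e v u * ⟦ A u ⟧)))
    where
    neg : ∀ a b → a * (+ 0 - b) ≡ - (a * b)
    neg = solve-∀

  fire-effective : ∀ {D A} → Legal D A → Effective {G} (λ v → D v - L (⟦_⟧ ∘ A) v)
  fire-effective legal v = ℤ.i≤j⇒0≤j-i (legal v)

  -- The set fired is the one on which the firing script z is maximal.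
  reaches⇒legal : ∀ {D q} → Effective {G} D → D q ℤ.≤ + 0 → Reaches D q →
    ∃ λ A → Legal D A × A q ≡ false × ∃ λ t → A t ≡ true
  reaches⇒legal {D} {q} 0≤D Dq≤0 (z , legal) with argmax q z
  ... | t , max = A , A-legal , dec-false (z q ℤ.≟ z t) q-not-max , t , dec-true (z t ℤ.≟ z t) refl
    where
    A : V → Bool
    A v = does (z v ℤ.≟ z t)

    -- At a maximum of `z` a vertex gains nothing, so the empty vertex `q` could not end up with a
    -- chip.
    q-not-max : z q ≢ z t
    q-not-max zq≡ = contradiction
      (ℤ.≤-trans (ℤ.+-mono-≤ 0≤Lzq (ℤ.≤-reflexive (sym (δ-refl q)))) (ℤ.≤-trans (legal q) Dq≤0))
      λ { (ℤ.+≤+ ()) }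
      where
      0≤Lzq : + 0 ℤ.≤ L z q
      0≤Lzq = subst (+ 0 ℤ.≤_) (sym (laplacian-differences z q))
        (sum-nonneg λ u → 0≤*0≤ (mult G q u)
          (ℤ.i≤j⇒0≤j-i (subst (z u ℤ.≤_) (sym zq≡) (max u))))

    A-legal : Legal D A
    A-legal v = by-cases (z v ℤ.≟ z t)
      where
      cancel : ∀ a b → (a + b) - a ≡ b - + 0
      cancel = solve-∀
      -- Across the boundary of `A` the integer script drops by at least one, so a vertex of `A`
      -- loses no more chips when `A` is fired once than under `z`.
      drop : z v ≡ z t → ∀ u → ⟦ not (A u) ⟧ ℤ.≤ z v - z u
      drop zv≡ u with z u ℤ.≟ z t
      ... | yes zu≡ = ℤ.≤-reflexive (sym (ℤ.i≡j⇒i-j≡0 (trans zv≡ (sym zu≡))))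
      ... | no zu≢ = shift-≤ (ℤ.i<j⇒suc[i]≤j (ℤ.≤∧≢⇒< (max u) zu≢))
                       (trans (cong (λ s → s - z u - + 1) zv≡) (regroup (z t) (z u)))
        where
        regroup : ∀ a b → a - b - + 1 ≡ a - (+ 1 + b)
        regroup = solve-∀
      by-cases : Dec (z v ≡ z t) → L (⟦_⟧ ∘ A) v ℤ.≤ D v
      by-cases (no zv≢) = ℤ.≤-trans (ℤ.≤-reflexive (laplacian-outside {A} (dec-false (z v ℤ.≟ z t) zv≢)))
        (ℤ.≤-trans (ℤ.neg-mono-≤ (sum-nonneg λ u → 0≤*0≤ (mult G v u) 0≤⟦ A u ⟧)) (0≤D v))
      by-cases (yes zv≡) = ℤ.≤-trans (ℤ.≤-reflexive (laplacian-inside {A} (dec-true (z v ℤ.≟ z t) zv≡)))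
        (ℤ.≤-trans (sum-mono λ u → ℤ.*-monoˡ-≤-nonNeg (e v u) (drop zv≡ u))
        (ℤ.≤-trans (ℤ.≤-reflexive (sym (laplacian-differences z v)))
        (ℤ.≤-trans (shift-≤ 0≤⟦ does (q ≟ v) ⟧ (cancel (L z v) (δ q v))) (legal v))))

  outdegree≤ : ∀ {D A v} → Legal D A → A v ≡ true → sumℤ (λ u → e v u * ⟦ not (A u) ⟧) ℤ.≤ D v
  outdegree≤ {D} {A} {v} legal v∈A = subst (ℤ._≤ D v) (laplacian-inside {A} v∈A) (legal v)

  private
    crossing : ∀ {A : V → Bool} {v u} → 1 ≤ mult G v u → A u ≡ false → + 1 ℤ.≤ e v u * ⟦ not (A u) ⟧
    crossing {A} {v} {u} vu u∉A =
      subst (λ b → + 1 ℤ.≤ e v u * ⟦ not b ⟧) (sym u∉A) (1≤*1 vu)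

    0≤crossing : ∀ (A : V → Bool) v u → + 0 ℤ.≤ e v u * ⟦ not (A u) ⟧
    0≤crossing A v u = 0≤*0≤ (mult G v u) 0≤⟦ not (A u) ⟧

  boundary⇒1≤ : ∀ {D A v u} → Legal D A → A v ≡ true → 1 ≤ mult G v u → A u ≡ false → + 1 ℤ.≤ D v
  boundary⇒1≤ {A = A} {v} {u} legal v∈A vu u∉A =
    ℤ.≤-trans (crossing {A} vu u∉A)
    (ℤ.≤-trans (term≤sum (0≤crossing A v) u) (outdegree≤ {A = A} legal v∈A))

  boundary⇒2≤ : ∀ {D A v u w} → Legal D A → A v ≡ true → u ≢ w →
    1 ≤ mult G v u → A u ≡ false → 1 ≤ mult G v w → A w ≡ false → + 2 ℤ.≤ D v
  boundary⇒2≤ {A = A} {v} {u} {w} legal v∈A u≢w vu u∉A vw w∉A =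
    ℤ.≤-trans (ℤ.+-mono-≤ (crossing {A} vu u∉A) (crossing {A} vw w∉A))
    (ℤ.≤-trans (two-terms≤sum (0≤crossing A v) u≢w) (outdegree≤ {A = A} legal v∈A))

  gains : ∀ {A v u} → A v ≡ false → A u ≡ true → 1 ≤ mult G v u → L (⟦_⟧ ∘ A) v ℤ.≤ - + 1
  gains {A} {v} {u} v∉A u∈A vu = subst (ℤ._≤ - + 1) (sym (laplacian-outside {A} v∉A))
    (ℤ.neg-mono-≤ (ℤ.≤-trans (subst (λ b → + 1 ℤ.≤ e v u * ⟦ b ⟧) (sym u∈A) (1≤*1 vu))
      (term≤sum (λ w → 0≤*0≤ (mult G v w) 0≤⟦ A w ⟧) u)))

  -- Sufficient conditions for reaching a vertex

  -- Vertices outside `A` only gain chips, and `q` gains one from its neighbour `u`, so the vertices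
  -- of `A` alone have to afford the firing.
  reaches-fromBoundary : ∀ {D A q u} → Effective {G} D → A q ≡ false → A u ≡ true → 1 ≤ mult G q u →
    (∀ v → A v ≡ true → sumℤ (λ w → e v w * ⟦ not (A w) ⟧) ℤ.≤ D v) → Reaches D q
  reaches-fromBoundary {D} {A} {q} {u} 0≤D q∉A u∈A qu boundary = ⟦_⟧ ∘ A , bound
    where
    bound : ∀ v → L (⟦_⟧ ∘ A) v + δ q v ℤ.≤ D v
    stays : ∀ {v} side → A v ≡ side → L (⟦_⟧ ∘ A) v ℤ.≤ D v
    stays {v} true Av = subst (ℤ._≤ D v) (sym (laplacian-inside {A} Av)) (boundary v Av)
    stays {v} false Av = ℤ.≤-trans (ℤ.≤-reflexive (laplacian-outside {A} Av))
      (ℤ.≤-trans (ℤ.neg-mono-≤ (sum-nonneg λ w → 0≤*0≤ (mult G v w) 0≤⟦ A w ⟧)) (0≤D v))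
    bound v with q ≟ v
    ... | yes refl = ℤ.≤-trans (ℤ.+-monoˡ-≤ (+ 1) (gains {A} q∉A u∈A qu)) (0≤D v)
    ... | no _ = subst (ℤ._≤ D v) (sym (ℤ.+-identityʳ _)) (stays (A v) refl)

  private
    true-outside : ∀ {r v : V} → not (does (r ≟ v)) ≡ true → v ≢ r
    true-outside {r} v∉ refl with trans (sym (cong not (dec-true (r ≟ r) refl))) v∉
    ... | ()

  -- Everything except `r` is fired, so each other vertex pays exactly its edges to `r`.
  reaches-vertex : ∀ {D r u} → Effective {G} D → u ≢ r → 1 ≤ mult G r u →
    (∀ v → v ≢ r → e v r ℤ.≤ D v) → Reaches D r
  reaches-vertex {D} {r} {u} 0≤D u≢r ru bound = reaches-fromBoundary {A = A} 0≤D
    (cong not (dec-true (r ≟ r) refl)) (cong not (dec-false (r ≟ u) (u≢r ∘ sym))) ru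
    λ v v∈A → subst (ℤ._≤ D v) (sym (trans
      (sum-cong λ w → cong (λ b → e v w * ⟦ b ⟧) (not-involutive (does (r ≟ w)))) (sum-δ (e v) r)))
      (bound v (true-outside v∈A))
    where
    A : V → Bool
    A v = not (does (r ≟ v))

  -- The complement of `r` and `s` is fired. The cost at `v` is estimated by a union bound, which
  -- also holds if `r` and `s` coincide.
  reaches-pair : ∀ {D r s q u} → Effective {G} D → q ≡ r ⊎ q ≡ s → u ≢ r → u ≢ s → 1 ≤ mult G q u →
    (∀ v → v ≢ r → v ≢ s → e v r + e v s ℤ.≤ D v) → Reaches D q
  reaches-pair {D} {r} {s} {q} {u} 0≤D q∈ u≢r u≢s qu bound =
    reaches-fromBoundary {A = not ∘ C} 0≤D (cong not (q∈C q∈))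
      (cong not (cong₂ _∨_ (dec-false (r ≟ u) (u≢r ∘ sym)) (dec-false (s ≟ u) (u≢s ∘ sym)))) qu
      λ v v∉C → ℤ.≤-trans (sum-mono λ w → term (mult G v w) (does (r ≟ w)) (does (s ≟ w)))
        (ℤ.≤-trans (ℤ.≤-reflexive (trans (sum-+ (λ w → e v w * δ r w) (λ w → e v w * δ s w))
                                        (cong₂ _+_ (sum-δ (e v) r) (sum-δ (e v) s))))
          (bound v (λ { refl → ≢-both v v∉C (inj₁ refl) }) (λ { refl → ≢-both v v∉C (inj₂ refl) })))
    where
    C : V → Bool
    C v = does (r ≟ v) ∨ does (s ≟ v)

    q∈C : ∀ {v} → v ≡ r ⊎ v ≡ s → C v ≡ true
    q∈C {v} (inj₁ refl) = cong (_∨ does (s ≟ v)) (dec-true (r ≟ v) refl)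
    q∈C {v} (inj₂ refl) = trans (cong (does (r ≟ v) ∨_) (dec-true (s ≟ v) refl)) (∨-zeroʳ _)

    ≢-both : ∀ v → not (C v) ≡ true → ¬ (v ≡ r ⊎ v ≡ s)
    ≢-both v v∉C v∈ with trans (sym (cong not (q∈C v∈))) v∉C
    ... | ()

    term : ∀ m b c → + m * ⟦ not (not (b ∨ c)) ⟧ ℤ.≤ + m * ⟦ b ⟧ + + m * ⟦ c ⟧
    term m b c = ℤ.≤-trans (ℤ.*-monoˡ-≤-nonNeg (+ m) (union b c))
      (ℤ.≤-reflexive (ℤ.*-distribˡ-+ (+ m) ⟦ b ⟧ ⟦ c ⟧))
      where
      union : ∀ b c → ⟦ not (not (b ∨ c)) ⟧ ℤ.≤ ⟦ b ⟧ + ⟦ c ⟧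
      union true true = ℤ.+≤+ (s≤s z≤n)
      union true false = ℤ.≤-refl
      union false true = ℤ.≤-refl
      union false false = ℤ.≤-refl

Reachable-trans : ∀ {G u v w} → Reachable G u v → Reachable G v w → Reachable G u w
Reachable-trans here r = r
Reachable-trans (step uw r) r′ = step uw (Reachable-trans r r′)

-- The graphs

module Construction (p′ t′ : ℕ) where

  p t M N : ℕ
  p = suc (suc p′)
  t = suc t′
  M = p ℕ.+ t
  N = p ℕ.+ (M ℕ.+ (t ℕ.+ t))

  data Vertex : Set where
    core    : Fin p → Vertex
    mid     : Fin M → Vertex
    hub tip : Fin t → Vertex

  -- One half of a bijection with `Fin N`, through which the graph and its divisors can be defined
  -- and examined by the kind of vertex.
  index : Vertex → Fin N
  index (core c) = c ↑ˡ _
  index (mid m) = p ↑ʳ (m ↑ˡ _)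
  index (hub k) = p ↑ʳ (M ↑ʳ (k ↑ˡ _))
  index (tip k) = p ↑ʳ (M ↑ʳ (t ↑ʳ k))

  vertex : Fin N → Vertex
  vertex v = [ core , (λ v → [ mid , (λ v → [ hub , tip ]′ (splitAt t v)) ]′ (splitAt M v)) ]′ (splitAt p v)

  vertex-index : ∀ x → vertex (index x) ≡ x
  vertex-index (core c) rewrite splitAt-↑ˡ p c (M ℕ.+ (t ℕ.+ t)) = refl
  vertex-index (mid m) rewrite splitAt-↑ʳ p (M ℕ.+ (t ℕ.+ t)) (m ↑ˡ _) | splitAt-↑ˡ M m (t ℕ.+ t) = refl
  vertex-index (hub k) rewrite splitAt-↑ʳ p (M ℕ.+ (t ℕ.+ t)) (M ↑ʳ (k ↑ˡ t))
    | splitAt-↑ʳ M (t ℕ.+ t) (k ↑ˡ t) | splitAt-↑ˡ t k t = refl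
  vertex-index (tip k) rewrite splitAt-↑ʳ p (M ℕ.+ (t ℕ.+ t)) (M ↑ʳ (t ↑ʳ k))
    | splitAt-↑ʳ M (t ℕ.+ t) (t ↑ʳ k) | splitAt-↑ʳ t t k = refl

  index-vertex : ∀ v → index (vertex v) ≡ v
  index-vertex v with splitAt p v in eq
  ... | inj₁ c = splitAt⁻¹-↑ˡ eq
  ... | inj₂ v₁ with splitAt M v₁ in eq₁
  ...   | inj₁ m = trans (cong (p ↑ʳ_) (splitAt⁻¹-↑ˡ eq₁)) (splitAt⁻¹-↑ʳ {m = p} eq)
  ...   | inj₂ v₂ with splitAt t v₂ in eq₂
  ...     | inj₁ k = trans (cong (λ w → p ↑ʳ (M ↑ʳ w)) (splitAt⁻¹-↑ˡ eq₂))
                      (trans (cong (p ↑ʳ_) (splitAt⁻¹-↑ʳ {m = M} eq₁)) (splitAt⁻¹-↑ʳ {m = p} eq))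
  ...     | inj₂ k = trans (cong (λ w → p ↑ʳ (M ↑ʳ w)) (splitAt⁻¹-↑ʳ {m = t} eq₂))
                      (trans (cong (p ↑ʳ_) (splitAt⁻¹-↑ʳ {m = M} eq₁)) (splitAt⁻¹-↑ʳ {m = p} eq))

  index-≢ : ∀ {x y} → x ≢ y → index x ≢ index y
  index-≢ {x} {y} x≢y eq = x≢y (trans (sym (vertex-index x)) (trans (cong vertex eq) (vertex-index y)))

  ∀-index : ∀ {P : Fin N → Set} → (∀ x → P (index x)) → ∀ v → P v
  ∀-index {P} Pindex v = subst P (index-vertex v) (Pindex (vertex v))

  count : Bool → ℕ
  count true = 1
  count false = 0

  -- Each edge is listed in one direction only. Adding both directions makes `adj` symmetric by
  -- commutativity, and `arc-antisym` keeps the sum at most one.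
  arc : Vertex → Vertex → ℕ
  arc (core _) (mid _) = 1
  arc (core _) (hub _) = 1
  arc (core zero) (tip _) = 1
  arc (hub k) (tip l) = count (does (k ≟ l))
  arc _ _ = 0

  adj : Vertex → Vertex → ℕ
  adj x y = arc x y ℕ.+ arc y x

  adj-sym : ∀ x y → adj x y ≡ adj y x
  adj-sym x y = ℕ.+-comm (arc x y) (arc y x)

  adj-irrefl : ∀ x → adj x x ≡ 0
  adj-irrefl (core _) = refl
  adj-irrefl (mid _) = refl
  adj-irrefl (hub _) = refl
  adj-irrefl (tip _) = refl

  arc≤1 : ∀ x y → arc x y ≤ 1
  arc≤1 (core _) (core _) = z≤n
  arc≤1 (core _) (mid _) = s≤s z≤n
  arc≤1 (core _) (hub _) = s≤s z≤n
  arc≤1 (core zero) (tip _) = s≤s z≤n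
  arc≤1 (core (suc _)) (tip _) = z≤n
  arc≤1 (mid _) _ = z≤n
  arc≤1 (hub _) (core _) = z≤n
  arc≤1 (hub _) (mid _) = z≤n
  arc≤1 (hub _) (hub _) = z≤n
  arc≤1 (hub k) (tip l) with does (k ≟ l)
  ... | true = s≤s z≤n
  ... | false = z≤n
  arc≤1 (tip _) _ = z≤n

  arc-antisym : ∀ x y → arc x y ≡ 0 ⊎ arc y x ≡ 0
  arc-antisym (core _) (core _) = inj₁ refl
  arc-antisym (core _) (mid _) = inj₂ refl
  arc-antisym (core _) (hub _) = inj₂ refl
  arc-antisym (core _) (tip _) = inj₂ refl
  arc-antisym (mid _) _ = inj₁ refl
  arc-antisym (hub _) (core _) = inj₁ refl
  arc-antisym (hub _) (mid _) = inj₁ refl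
  arc-antisym (hub _) (hub _) = inj₁ refl
  arc-antisym (hub _) (tip _) = inj₂ refl
  arc-antisym (tip _) _ = inj₁ refl

  adj≤1 : ∀ x y → adj x y ≤ 1
  adj≤1 x y with arc-antisym x y
  ... | inj₁ xy≡0 rewrite xy≡0 = arc≤1 y x
  ... | inj₂ yx≡0 rewrite yx≡0 | ℕ.+-identityʳ (arc x y) = arc≤1 x y

  graph : Graph
  graph = record
    { n = N
    ; mult = λ u v → adj (vertex u) (vertex v)
    ; symmetric = λ u v → adj-sym (vertex u) (vertex v)
    ; loopless = adj-irrefl ∘ vertex
    }

  simple : Simple graph
  simple u v = adj≤1 (vertex u) (vertex v)

  mult-index : ∀ x y → mult graph (index x) (index y) ≡ adj x y
  mult-index x y = cong₂ adj (vertex-index x) (vertex-index y)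

  edge : ∀ x y → 1 ≤ adj x y → 1 ≤ mult graph (index x) (index y)
  edge x y = subst (1 ≤_) (sym (mult-index x y))

  hub-tip : ∀ k → 1 ≤ adj (hub k) (tip k)
  hub-tip k rewrite dec-true (k ≟ k) refl = s≤s z≤n

  -- `a` is the core vertex joined to all tips; `b` is a second core vertex, available because `p`
  -- is at least two.
  a b : Vertex
  a = core zero
  b = core (suc zero)

  connected : Connected graph
  connected u v = Reachable-trans (∀-index {λ u → Reachable graph u (index a)} to-a u)
                                  (∀-index {Reachable graph (index a)} from-a v)
    where
    to-a : ∀ x → Reachable graph (index x) (index a)
    to-a (core c) = step {w = index (mid zero)} (edge (core c) (mid zero) (s≤s z≤n))
                      (step (edge (mid zero) a (s≤s z≤n)) here)
    to-a (mid m) = step (edge (mid m) a (s≤s z≤n)) here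
    to-a (hub k) = step (edge (hub k) a (s≤s z≤n)) here
    to-a (tip k) = step (edge (tip k) a (s≤s z≤n)) here
    from-a : ∀ x → Reachable graph (index a) (index x)
    from-a (core c) = step {w = index (mid zero)} (edge a (mid zero) (s≤s z≤n))
                        (step (edge (mid zero) (core c) (s≤s z≤n)) here)
    from-a (mid m) = step (edge a (mid m) (s≤s z≤n)) here
    from-a (hub k) = step (edge a (hub k) (s≤s z≤n)) here
    from-a (tip k) = step (edge a (tip k) (s≤s z≤n)) here

  -- Degree split by kind of vertex

  sum-vertices : ∀ (D : Fin N → ℤ) → sumℤ D ≡
    sumℤ (λ c → D (index (core c))) + (sumℤ (λ m → D (index (mid m)))
      + (sumℤ (λ k → D (index (hub k))) + sumℤ (λ k → D (index (tip k)))))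
  sum-vertices D = trans (sum-splitAt p D) (cong (λ s → sumℤ (λ c → D (index (core c))) + s)
    (trans (sum-splitAt M (λ v → D (p ↑ʳ v))) (cong (λ s → sumℤ (λ m → D (index (mid m))) + s)
      (sum-splitAt t (λ v → D (p ↑ʳ (M ↑ʳ v)))))))

  module EffectiveSums {D : Fin N → ℤ} (0≤D : ∀ v → + 0 ℤ.≤ D v) where

    parts≤sum : ∀ {w x y z} → w ℤ.≤ sumℤ (λ c → D (index (core c))) → x ℤ.≤ sumℤ (λ m → D (index (mid m))) →
      y ℤ.≤ sumℤ (λ k → D (index (hub k))) → z ℤ.≤ sumℤ (λ k → D (index (tip k))) →
      w + (x + (y + z)) ℤ.≤ sumℤ D
    parts≤sum {w} {x} {y} {z} w≤ x≤ y≤ z≤ = subst ((w + (x + (y + z))) ℤ.≤_) (sym (sum-vertices D))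
      (ℤ.+-mono-≤ w≤ (ℤ.+-mono-≤ x≤ (ℤ.+-mono-≤ y≤ z≤)))

    0≤part : ∀ {n} (f : Fin n → Vertex) → + 0 ℤ.≤ sumℤ (λ k → D (index (f k)))
    0≤part f = sum-nonneg (λ k → 0≤D (index (f k)))

    term≤part : ∀ {n} (f : Fin n → Vertex) k → D (index (f k)) ℤ.≤ sumℤ (λ k → D (index (f k)))
    term≤part f = term≤sum (λ k → 0≤D (index (f k)))

    core+mids≤sum : ∀ c → D (index (core c)) + sumℤ (λ m → D (index (mid m))) ℤ.≤ sumℤ D
    core+mids≤sum c = subst (ℤ._≤ sumℤ D)
      (cong (λ s → D (index (core c)) + s) (ℤ.+-identityʳ _))
      (parts≤sum (term≤part core c) ℤ.≤-refl (0≤part hub) (0≤part tip))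

    mids≤sum : sumℤ (λ m → D (index (mid m))) ℤ.≤ sumℤ D
    mids≤sum = subst (ℤ._≤ sumℤ D) (ℤ.+-identityˡ _)
      (ℤ.≤-trans (ℤ.+-monoˡ-≤ _ (0≤D (index a))) (core+mids≤sum zero))

  open EffectiveSums

  -- Each of the M mids sends an edge of the cut to one of two separated core vertices.
  core-together : ∀ {D A} → Effective {graph} D → ¬ (+ M ℤ.≤ sumℤ D) → Legal graph D A →
    ∀ {c d} → A (index (core c)) ≡ true → A (index (core d)) ≡ false → ⊥
  core-together {D} {A} 0≤D M≰ legal {c} {d} c∈A d∉A = M≰ (begin
    + M
      ≡⟨ sym (sum-ones M) ⟩
    sumℤ {M} (λ _ → + 1)
      ≡⟨ sum-cong (λ m → sym (⟦b⟧+⟦not-b⟧≡1 (A′ m))) ⟩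
    sumℤ (λ m → ⟦ A′ m ⟧ + ⟦ not (A′ m) ⟧)
      ≡⟨ sum-+ (λ m → ⟦ A′ m ⟧) (λ m → ⟦ not (A′ m) ⟧) ⟩
    sumℤ (λ m → ⟦ A′ m ⟧) + sumℤ (λ m → ⟦ not (A′ m) ⟧)
      ≤⟨ ℤ.+-mono-≤ (sum-mono inside) outside ⟩
    sumℤ (λ m → D (index (mid m))) + D (index (core c))
      ≡⟨ ℤ.+-comm (sumℤ (λ m → D (index (mid m)))) (D (index (core c))) ⟩
    D (index (core c)) + sumℤ (λ m → D (index (mid m)))
      ≤⟨ core+mids≤sum 0≤D c ⟩
    sumℤ D ∎)
    where
    open ℤ.≤-Reasoning
    A′ : Fin M → Bool
    A′ m = A (index (mid m))
    inside : ∀ m → ⟦ A′ m ⟧ ℤ.≤ D (index (mid m))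
    inside m with A′ m in m∈A
    ... | true = boundary⇒1≤ graph {A = A} legal m∈A (edge (mid m) (core d) (s≤s z≤n)) d∉A
    ... | false = 0≤D (index (mid m))
    crossing : Fin N → ℤ
    crossing u = + mult graph (index (core c)) u * ⟦ not (A u) ⟧
    to-mid : ∀ m → ⟦ not (A′ m) ⟧ ≡ crossing (index (mid m))
    to-mid m = trans (sym (ℤ.*-identityˡ _))
      (cong (λ k → + k * ⟦ not (A′ m) ⟧) (sym (mult-index (core c) (mid m))))
    outside : sumℤ (λ m → ⟦ not (A′ m) ⟧) ℤ.≤ D (index (core c))
    outside = ℤ.≤-trans (ℤ.≤-reflexive (sum-cong to-mid))
      (ℤ.≤-trans (mids≤sum (λ u → 0≤*0≤ (mult graph (index (core c)) u) 0≤⟦ not (A u) ⟧))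
                 (outdegree≤ graph {A = A} legal c∈A))

  -- Lower bounds on the two gonalities

  -- In either case a suitable empty mid or tip outside a legally fired set forces some core vertex
  -- out as well, and in degree below `M` the whole core follows.
  Sparse : (Fin N → ℤ) → Set
  Sparse D = (∃ λ c → D (index (core c)) ℤ.≤ + 0)
    ⊎ (∃ λ k → D (index (hub k)) ℤ.≤ + 0 × D (index (tip k)) ℤ.≤ + 0) × D (index a) ℤ.≤ + 1

  module _ {D : Fin N → ℤ} (0≤D : Effective {graph} D) (M≰ : ¬ (+ M ℤ.≤ sumℤ D)) where

    empty-mid : ∃ λ m → D (index (mid m)) ℤ.≤ + 0
    empty-mid with any? (λ m → D (index (mid m)) ℤ.≤? + 0)
    ... | yes found = found
    ... | no none = contradiction
      (ℤ.≤-trans (sum-atLeast-ones (λ m → ≰0⇒1≤ (λ ≤0 → none (m , ≤0)))) (mids≤sum 0≤D)) M≰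

    CoreFreeFiring : Set
    CoreFreeFiring = ∃ λ A → Legal graph D A × (∀ c → A (index (core c)) ≡ false) × ∃ λ u → A u ≡ true

    core-free : ∀ {A} c → Legal graph D A → A (index (core c)) ≡ false → ∀ d → A (index (core d)) ≡ false
    core-free {A} c legal c∉A d = ¬-not λ d∈A → core-together {A = A} 0≤D M≰ legal d∈A c∉A

    -- Start the fire at an empty mid if the core vertex c is empty, and at the tip k otherwise.
    sparse⇒coreFreeFiring : (∀ q → Reaches graph D q) → Sparse D → CoreFreeFiring
    sparse⇒coreFreeFiring reach (inj₁ (c , c≤0)) =
      let m , m≤0 = empty-mid
          A , legal , m∉A , nonempty = reaches⇒legal graph 0≤D m≤0 (reach (index (mid m)))
      in A , legal , core-free {A} c legal (c∉A legal m∉A) , nonempty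
      where
      c∉A : ∀ {A m} → Legal graph D A → A (index (mid m)) ≡ false → A (index (core c)) ≡ false
      c∉A {A} {m} legal m∉A = ¬-not λ c∈A → contradiction
        (ℤ.≤-trans (boundary⇒1≤ graph {A = A} legal c∈A (edge (core c) (mid m) (s≤s z≤n)) m∉A) c≤0)
        λ { (ℤ.+≤+ ()) }
    sparse⇒coreFreeFiring reach (inj₂ ((k , hub≤0 , tip≤0) , a≤1)) =
      let A , legal , tip∉A , nonempty = reaches⇒legal graph 0≤D tip≤0 (reach (index (tip k)))
      in A , legal , core-free {A} zero legal (a∉A legal tip∉A (hub∉A legal tip∉A)) , nonempty
      where
      hub∉A : ∀ {A} → Legal graph D A → A (index (tip k)) ≡ false → A (index (hub k)) ≡ false
      hub∉A {A} legal tip∉A = ¬-not λ hub∈A → contradiction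
        (ℤ.≤-trans (boundary⇒1≤ graph {A = A} legal hub∈A (edge (hub k) (tip k) (hub-tip k)) tip∉A) hub≤0)
        λ { (ℤ.+≤+ ()) }
      a∉A : ∀ {A} → Legal graph D A → A (index (tip k)) ≡ false → A (index (hub k)) ≡ false →
        A (index a) ≡ false
      a∉A {A} legal tip∉A hub∉A = ¬-not λ a∈A → contradiction
        (ℤ.≤-trans (boundary⇒2≤ graph {A = A} legal a∈A (index-≢ {tip k} {hub k} λ ())
          (edge a (tip k) (s≤s z≤n)) tip∉A (edge a (hub k) (s≤s z≤n)) hub∉A) a≤1)
        λ { (ℤ.+≤+ (s≤s ())) }

  -- A fired mid or hub has edges to both `a` and `b`, which stay behind. A fired tip either has its
  -- hub fired too, or has its edges to `a` and to the hub leaving the set.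
  coreFree⇒2≤ : ∀ {D A} → Legal graph D A → (∀ c → A (index (core c)) ≡ false) →
    ∀ x → A (index x) ≡ true → ∃ λ y → + 2 ℤ.≤ D (index y)
  coreFree⇒2≤ {D} {A} legal free = go
    where
    near-core : ∀ x → 1 ≤ adj x a → 1 ≤ adj x b → A (index x) ≡ true → ∃ λ y → + 2 ℤ.≤ D (index y)
    near-core x xa xb x∈A = x , boundary⇒2≤ graph {A = A} legal x∈A (index-≢ {a} {b} λ ())
      (edge x a xa) (free zero) (edge x b xb) (free (suc zero))
    go : ∀ x → A (index x) ≡ true → ∃ λ y → + 2 ℤ.≤ D (index y)
    go (core c) c∈A with trans (sym c∈A) (free c)
    ... | ()
    go (mid m) = near-core (mid m) (s≤s z≤n) (s≤s z≤n)
    go (hub k) = near-core (hub k) (s≤s z≤n) (s≤s z≤n)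
    go (tip k) tip∈A with A (index (hub k)) in hubA
    ... | true = go (hub k) hubA
    ... | false = tip k , boundary⇒2≤ graph {A = A} legal tip∈A (index-≢ {a} {hub k} λ ())
      (edge (tip k) a (s≤s z≤n)) (free zero)
      (edge (tip k) (hub k) (subst (1 ≤_) (adj-sym (hub k) (tip k)) (hub-tip k))) hubA

  private
    -- The nested sum is the shape produced by `parts≤sum` with one chip beyond the core; for a hub
    -- and for a tip it computes to the same number.
    1+n≰n : ∀ {n m} → + n + (+ 0 + (+ 1 + + 0)) ℤ.≤ m → m ℤ.≤ + n → ⊥
    1+n≰n {n} 1+n≤m m≤n = ℕ.<-irrefl refl
      (subst (ℕ._≤ n) (ℕ.+-comm n 1) (ℤ.drop‿+≤+ (ℤ.≤-trans 1+n≤m m≤n)))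

  -- One chip on each core vertex and one on each hub-tip pair already make `p + t = M`. Below that
  -- degree one of them is missing, so `D` is sparse and has to fire a set avoiding the core, for
  -- which some vertex needs two chips.
  multiplicityFree-bound : ∀ D → MultiplicityFree {graph} D → PositiveRank {graph} D → + M ℤ.≤ deg {graph} D
  multiplicityFree-bound D (0≤D , D≤1) rank with + M ℤ.≤? sumℤ D
  ... | yes M≤ = M≤
  ... | no M≰ = contradiction too-many λ { (ℤ.+≤+ (s≤s ())) }
    where
    sparse : Sparse D
    sparse with any? (λ c → D (index (core c)) ℤ.≤? + 0)
    ... | yes empty = inj₁ empty
    ... | no full with any? (λ k → (D (index (hub k)) ℤ.≤? + 0) ×-dec (D (index (tip k)) ℤ.≤? + 0))
    ...   | yes empty = inj₂ (empty , D≤1 (index a))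
    ...   | no covered = contradiction (subst (ℤ._≤ sumℤ D) (cong (λ s → + p + s) (ℤ.+-identityˡ (+ t)))
        (ℤ.≤-trans (ℤ.+-mono-≤ (sum-atLeast-ones (λ c → ≰0⇒1≤ (λ ≤0 → full (c , ≤0))))
          (ℤ.+-mono-≤ (0≤part 0≤D mid) (ℤ.≤-trans (sum-atLeast-ones covered⇒1≤)
            (ℤ.≤-reflexive (sum-+ (λ k → D (index (hub k))) (λ k → D (index (tip k))))))))
          (ℤ.≤-reflexive (sym (sum-vertices D))))) M≰
      where
      covered⇒1≤ : ∀ k → + 1 ℤ.≤ D (index (hub k)) + D (index (tip k))
      covered⇒1≤ k with D (index (hub k)) ℤ.≤? + 0
      ... | no hub≰0 = ℤ.+-mono-≤ (≰0⇒1≤ hub≰0) (0≤D (index (tip k)))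
      ... | yes hub≤0 = ℤ.+-mono-≤ (0≤D (index (hub k))) (≰0⇒1≤ (λ tip≤0 → covered (k , hub≤0 , tip≤0)))
    too-many : + 2 ℤ.≤ + 1
    too-many =
      let A , legal , free , u , u∈A = sparse⇒coreFreeFiring 0≤D M≰ (positiveRank⇒reaches graph D rank) sparse
          y , 2≤y = coreFree⇒2≤ {A = A} legal free (vertex u) (trans (cong A (index-vertex u)) u∈A)
      in ℤ.≤-trans 2≤y (D≤1 (index y))

  -- A core without empty vertices uses up all `p` chips, which leaves none for a hub, a tip or a
  -- second chip on `a`. Since `t` is positive, the first hub-tip pair can serve as the empty one.
  small⇒sparse : ∀ {D} → Effective {graph} D → sumℤ D ℤ.≤ + p → Sparse D
  small⇒sparse {D} 0≤D D≤p with any? (λ c → D (index (core c)) ℤ.≤? + 0)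
  ... | yes empty = inj₁ empty
  ... | no full = inj₂ ((zero , hub≤0 , tip≤0) , a≤1)
    where
    1≤core : ∀ c → + 1 ℤ.≤ D (index (core c))
    1≤core c = ≰0⇒1≤ (λ ≤0 → full (c , ≤0))
    hub≤0 : D (index (hub zero)) ℤ.≤ + 0
    hub≤0 with D (index (hub zero)) ℤ.≤? + 0
    ... | yes ≤0 = ≤0
    ... | no ≰0 = ⊥-elim (1+n≰n (parts≤sum 0≤D (sum-atLeast-ones 1≤core) (0≤part 0≤D mid)
      (ℤ.≤-trans (≰0⇒1≤ ≰0) (term≤part 0≤D hub zero)) (0≤part 0≤D tip)) D≤p)
    tip≤0 : D (index (tip zero)) ℤ.≤ + 0
    tip≤0 with D (index (tip zero)) ℤ.≤? + 0
    ... | yes ≤0 = ≤0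
    ... | no ≰0 = ⊥-elim (1+n≰n (parts≤sum 0≤D (sum-atLeast-ones 1≤core) (0≤part 0≤D mid)
      (0≤part 0≤D hub) (ℤ.≤-trans (≰0⇒1≤ ≰0) (term≤part 0≤D tip zero))) D≤p)
    a≤1 : D (index a) ℤ.≤ + 1
    a≤1 with D (index a) ℤ.≤? + 1
    ... | yes ≤1 = ≤1
    ... | no ≰1 = ⊥-elim (ℕ.<-irrefl refl (ℤ.drop‿+≤+ (ℤ.≤-trans
      (ℤ.+-mono-≤ (ℤ.i<j⇒suc[i]≤j (ℤ.≰⇒> ≰1)) (sum-atLeast-ones (1≤core ∘ suc)))
      (ℤ.≤-trans (subst (ℤ._≤ sumℤ D) (ℤ.+-identityʳ _)
        (parts≤sum 0≤D ℤ.≤-refl (0≤part 0≤D mid) (0≤part 0≤D hub) (0≤part 0≤D tip))) D≤p))))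

  -- Every core-free firing brings a chip to a, so it can be repeated only finitely often.
  no-small-effective : ∀ k {D} → Effective {graph} D → (∀ q → Reaches graph D q) → sumℤ D ℤ.≤ + p →
    + 1 + sumℤ D ℤ.≤ D (index a) + + k → ⊥
  no-small-effective k {D} 0≤D reach D≤p fuel = next k fuel
    where
    M≰ : ¬ (+ M ℤ.≤ sumℤ D)
    M≰ M≤ = ℕ.m+1+n≰m p (ℤ.drop‿+≤+ (ℤ.≤-trans M≤ D≤p))
    meets-a : ∀ {A} → (∀ c → A (index (core c)) ≡ false) → ∀ x → A (index x) ≡ true → 1 ≤ adj a x
    meets-a free (core c) c∈A with trans (sym c∈A) (free c)
    ... | ()
    meets-a free (mid m) _ = s≤s z≤n
    meets-a free (hub k) _ = s≤s z≤n
    meets-a free (tip k) _ = s≤s z≤n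
    next : ∀ k → + 1 + sumℤ D ℤ.≤ D (index a) + + k → ⊥
    -- The counter `k` bounds the remaining firings: each one keeps the degree and adds a chip to
    -- `a`. At zero, `a` alone would hold more than the whole degree.
    next zero fuel = ℤ.<-irrefl refl (ℤ.suc[i]≤j⇒i<j (ℤ.≤-trans fuel
      (ℤ.≤-trans (ℤ.≤-reflexive (ℤ.+-identityʳ (D (index a)))) (term≤sum 0≤D (index a)))))
    next (suc k) fuel with sparse⇒coreFreeFiring 0≤D M≰ reach (small⇒sparse 0≤D D≤p)
    ... | A , legal , free , u , u∈A = no-small-effective k
        (fire-effective graph {A = A} legal)
        (λ q → reaches-fire graph D {q} (⟦_⟧ ∘ A) (reach q))
        (subst (ℤ._≤ + p) (sym same-degree) D≤p)
        (subst (λ s → + 1 + s ℤ.≤ D (index a) - La + + k) (sym same-degree)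
          (shift-≤ (ℤ.+-mono-≤ fuel a-gains) (regroup (D (index a)) La (+ k) (sumℤ D))))
      where
      La = laplacian graph (⟦_⟧ ∘ A) (index a)
      same-degree = deg-fire graph D (⟦_⟧ ∘ A)
      x∈A : A (index (vertex u)) ≡ true
      x∈A = trans (cong A (index-vertex u)) u∈A
      a-gains : La ℤ.≤ - + 1
      a-gains = gains graph {A} (free zero) x∈A (edge a (vertex u) (meets-a {A} free (vertex u) x∈A))
      regroup : ∀ x l k s → (x - l + k) - (+ 1 + s) ≡ (x + (+ 1 + k) + - + 1) - (+ 1 + s + l)
      regroup = solve-∀

  -- `D` itself may fail to be effective. The script by which it reaches `a` yields an equivalent
  -- effective divisor `E` of the same degree that still reaches every vertex.
  gonality-bound : ∀ D → PositiveRank {graph} D → + suc p ℤ.≤ deg {graph} D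
  gonality-bound D rank with + suc p ℤ.≤? sumℤ D
  ... | yes p< = p<
  -- The initial counter `1 + deg E` suffices because `E` is nonnegative at `a`.
  ... | no p≮ = ⊥-elim (no-small-effective (suc ℤ.∣ sumℤ E ∣) 0≤E
      (λ q → reaches-fire graph D {q} z (positiveRank⇒reaches graph D rank q))
      (subst (ℤ._≤ + p) (sym (deg-fire graph D z)) (ℤ.i<j⇒i≤pred[j] (ℤ.≰⇒> p≮)))
      (subst (λ s → + 1 + s ℤ.≤ E (index a) + + suc ℤ.∣ sumℤ E ∣) (ℤ.0≤i⇒+∣i∣≡i (sum-nonneg 0≤E))
        (subst (ℤ._≤ E (index a) + + suc ℤ.∣ sumℤ E ∣) (ℤ.+-identityˡ _) (ℤ.+-monoˡ-≤ _ (0≤E (index a))))))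
    where
    z = proj₁ (positiveRank⇒reaches graph D rank (index a))
    E : Fin N → ℤ
    E v = D v - laplacian graph z v
    0≤E : ∀ v → + 0 ℤ.≤ E v
    0≤E v = shift-≤ (ℤ.≤-trans (ℤ.+-monoʳ-≤ (laplacian graph z v) 0≤⟦ does (index a ≟ v) ⟧)
      (proj₂ (positiveRank⇒reaches graph D rank (index a)) v)) (regroup (D v) (laplacian graph z v))
      where
      regroup : ∀ x l → (x - l) - + 0 ≡ x - (l + + 0)
      regroup = solve-∀

  -- Divisors attaining the bounds

  gonalityDivisor : Vertex → ℤ
  gonalityDivisor (core zero) = + 2
  gonalityDivisor (core (suc _)) = + 1
  gonalityDivisor _ = + 0

  multiplicityFreeDivisor : Vertex → ℤ
  multiplicityFreeDivisor (core _) = + 1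
  multiplicityFreeDivisor (hub _) = + 1
  multiplicityFreeDivisor _ = + 0

  deg-∘vertex : ∀ (f : Vertex → ℤ) → sumℤ (f ∘ vertex) ≡
    sumℤ (f ∘ core) + (sumℤ (f ∘ mid) + (sumℤ (f ∘ hub) + sumℤ (f ∘ tip)))
  deg-∘vertex f = trans (sum-vertices (f ∘ vertex))
    (cong₂ _+_ (part core) (cong₂ _+_ (part mid) (cong₂ _+_ (part hub) (part tip))))
    where
    part : ∀ {n} (g : Fin n → Vertex) → sumℤ (λ k → f (vertex (index (g k)))) ≡ sumℤ (f ∘ g)
    part g = sum-cong (λ k → cong f (vertex-index (g k)))

  module _ (f : Vertex → ℤ) (0≤f : ∀ x → + 0 ℤ.≤ f x) where

    private
      D : Fin N → ℤ
      D = f ∘ vertex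

      0≤D : ∀ v → + 0 ℤ.≤ D v
      0≤D v = 0≤f (vertex v)

    reaches-covered : ∀ x → + 1 ℤ.≤ f x → Reaches graph D (index x)
    reaches-covered x 1≤fx = reaches-support graph {q = index x} 0≤D
      (subst (+ 1 ℤ.≤_) (cong f (sym (vertex-index x))) 1≤fx)

    reaches-isolated : ∀ x → 1 ≤ adj x a → (∀ y → + adj y x ℤ.≤ f y) → Reaches graph D (index x)
    reaches-isolated x xa bound = reaches-vertex graph {r = index x} {index a} 0≤D
      (index-≢ {a} {x} (distinct xa)) (edge x a xa)
      λ v _ → subst (λ y → + adj (vertex v) y ℤ.≤ D v) (sym (vertex-index x)) (bound (vertex v))
      where
      distinct : ∀ {x} → 1 ≤ adj x a → a ≢ x
      distinct () refl

    reaches-hub-tip : ∀ k → (∀ y → y ≢ hub k → y ≢ tip k → + adj y (hub k) + + adj y (tip k) ℤ.≤ f y) →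
      ∀ x → x ≡ hub k ⊎ x ≡ tip k → Reaches graph D (index x)
    reaches-hub-tip k bound x x∈ =
      reaches-pair graph {r = index (hub k)} {index (tip k)} {index x} {index a} 0≤D
      (map-index x∈) (index-≢ {a} {hub k} λ ()) (index-≢ {a} {tip k} λ ())
      (edge x a (x~a x∈))
      λ v v≢hub v≢tip → subst₂ (λ y z → + adj (vertex v) y + + adj (vertex v) z ℤ.≤ D v)
        (sym (vertex-index (hub k))) (sym (vertex-index (tip k)))
        (bound (vertex v) (v≢hub ∘ from-vertex) (v≢tip ∘ from-vertex))
      where
      map-index : x ≡ hub k ⊎ x ≡ tip k → index x ≡ index (hub k) ⊎ index x ≡ index (tip k)
      map-index (inj₁ refl) = inj₁ refl
      map-index (inj₂ refl) = inj₂ refl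
      x~a : x ≡ hub k ⊎ x ≡ tip k → 1 ≤ adj x a
      x~a (inj₁ refl) = s≤s z≤n
      x~a (inj₂ refl) = s≤s z≤n
      from-vertex : ∀ {v y} → vertex v ≡ y → v ≡ index y
      from-vertex {v} refl = sym (index-vertex v)

  count-≢ : ∀ {n} {k l : Fin n} → k ≢ l → count (does (k ≟ l)) ≡ 0
  count-≢ {k = k} {l} k≢l = cong count (dec-false (k ≟ l) k≢l)

  gonality : GonalityIs graph (suc p)
  gonality = (gonalityDivisor ∘ vertex , reaches⇒positiveRank graph (∀-index reach) , degree) , gonality-bound
    where
    f = gonalityDivisor
    0≤f : ∀ x → + 0 ℤ.≤ f x
    0≤f (core zero) = ℤ.+≤+ z≤n
    0≤f (core (suc _)) = ℤ.+≤+ z≤n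
    0≤f (mid _) = ℤ.≤-refl
    0≤f (hub _) = ℤ.≤-refl
    0≤f (tip _) = ℤ.≤-refl
    degree : sumℤ (f ∘ vertex) ≡ + suc p
    degree = trans (deg-∘vertex f) (trans
      (cong₂ _+_ (cong (λ s → + 2 + s) (sum-ones (suc p′)))
        (cong₂ _+_ (sum-zero M) (cong₂ _+_ (sum-zero t) (sum-zero t))))
      (ℤ.+-identityʳ (+ suc p)))
    around-mid : ∀ m y → + adj y (mid m) ℤ.≤ f y
    around-mid m (core zero) = ℤ.+≤+ (s≤s z≤n)
    around-mid m (core (suc _)) = ℤ.≤-refl
    around-mid m (mid _) = ℤ.≤-refl
    around-mid m (hub _) = ℤ.≤-refl
    around-mid m (tip _) = ℤ.≤-refl
    -- `a` pays one chip to hub `k` and one to tip `k`, every other core vertex pays only the hub,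
    -- and the other hubs and tips have no edge to this pair.
    around-hub-tip : ∀ k y → y ≢ hub k → y ≢ tip k → + adj y (hub k) + + adj y (tip k) ℤ.≤ f y
    around-hub-tip k (core zero) _ _ = ℤ.≤-refl
    around-hub-tip k (core (suc _)) _ _ = ℤ.≤-refl
    around-hub-tip k (mid _) _ _ = ℤ.≤-refl
    around-hub-tip k (hub l) l≢k _ rewrite count-≢ {k = l} {k} (l≢k ∘ cong hub) = ℤ.≤-refl
    around-hub-tip k (tip l) _ l≢k rewrite count-≢ {k = k} {l} (l≢k ∘ cong tip ∘ sym) = ℤ.≤-refl
    reach : ∀ x → Reaches graph (f ∘ vertex) (index x)
    reach (core zero) = reaches-covered f 0≤f a (ℤ.+≤+ (s≤s z≤n))
    reach (core (suc c)) = reaches-covered f 0≤f (core (suc c)) ℤ.≤-refl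
    reach (mid m) = reaches-isolated f 0≤f (mid m) (s≤s z≤n) (around-mid m)
    reach (hub k) = reaches-hub-tip f 0≤f k (around-hub-tip k) (hub k) (inj₁ refl)
    reach (tip k) = reaches-hub-tip f 0≤f k (around-hub-tip k) (tip k) (inj₂ refl)

  multiplicityFreeGonality : MFGonalityIs graph M
  multiplicityFreeGonality =
    (f ∘ vertex , (0≤f ∘ vertex , f≤1 ∘ vertex) , reaches⇒positiveRank graph (∀-index reach) , degree)
    , multiplicityFree-bound
    where
    f = multiplicityFreeDivisor
    0≤f : ∀ x → + 0 ℤ.≤ f x
    0≤f (core _) = ℤ.+≤+ z≤n
    0≤f (mid _) = ℤ.≤-refl
    0≤f (hub _) = ℤ.+≤+ z≤n
    0≤f (tip _) = ℤ.≤-refl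
    f≤1 : ∀ x → f x ℤ.≤ + 1
    f≤1 (core _) = ℤ.≤-refl
    f≤1 (mid _) = ℤ.+≤+ z≤n
    f≤1 (hub _) = ℤ.≤-refl
    f≤1 (tip _) = ℤ.+≤+ z≤n
    degree : sumℤ (f ∘ vertex) ≡ + M
    degree = trans (deg-∘vertex f) (trans
      (cong₂ _+_ (sum-ones p) (cong₂ _+_ (sum-zero M) (cong₂ _+_ (sum-ones t) (sum-zero t))))
      (cong (λ s → + (p ℕ.+ s)) (ℕ.+-identityʳ t)))
    around-mid : ∀ m y → + adj y (mid m) ℤ.≤ f y
    around-mid m (core _) = ℤ.≤-refl
    around-mid m (mid _) = ℤ.≤-refl
    around-mid m (hub _) = ℤ.+≤+ z≤n
    around-mid m (tip _) = ℤ.≤-refl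
    -- Every core vertex and every hub holds a chip, so simplicity of the graph is enough to cover
    -- its possible edge to the tip.
    around-tip : ∀ k y → + adj y (tip k) ℤ.≤ f y
    around-tip k (core c) = ℤ.+≤+ (adj≤1 (core c) (tip k))
    around-tip k (mid _) = ℤ.≤-refl
    around-tip k (hub l) = ℤ.+≤+ (adj≤1 (hub l) (tip k))
    around-tip k (tip _) = ℤ.≤-refl
    reach : ∀ x → Reaches graph (f ∘ vertex) (index x)
    reach (core c) = reaches-covered f 0≤f (core c) ℤ.≤-refl
    reach (mid m) = reaches-isolated f 0≤f (mid m) (s≤s z≤n) (around-mid m)
    reach (hub k) = reaches-covered f 0≤f (hub k) ℤ.≤-refl
    reach (tip k) = reaches-isolated f 0≤f (tip k) (s≤s z≤n) (around-tip k)

theorem4p2 : (i j : ℕ) → 3 ≤ i → i ≤ j →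
    Σ Graph (λ G → Connected G × Simple G × GonalityIs G i × MFGonalityIs G j)
theorem4p2 (suc (suc (suc i′))) j (s≤s (s≤s (s≤s z≤n))) i≤j =
  graph , connected , simple , gonality , subst (MFGonalityIs graph) M≡j multiplicityFreeGonality
  where
  -- With `i = 3 + i′` the core has `p = 2 + i′ = i - 1` vertices and `t = (j - i) + 1`, so that
  -- `suc p` is `i` and `M` is `j`. The truncated subtraction is exact because `i ≤ j`.
  open Construction i′ (j ℕ.∸ (3 ℕ.+ i′))
  M≡j : M ≡ j
  M≡j = trans (ℕ.+-suc p (j ℕ.∸ (3 ℕ.+ i′))) (ℕ.m+[n∸m]≡n i≤j)
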